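{- Let $T=\{1,2,3,4,5,6\}$ and $$\mathcal{M}_3:=\{\{(12,\sigma_1),(34,\sigma_2),(56,\sigma_3)\}\mid \sigma_1,\sigma_2,\sigma_3\in\{\mathrm{odd},\mathrm{even}\}\}.$$ Then $\mathcal{M}_3$ is not h-representable.
   Context: Let $T=\{1,2,\dots,2\tau\}$ (here $\tau=3$). A perfect matching with parity (PMP) on $T$ is a set of pairs $(s_it_i,\sigma_i)$ $(i=1,\dots,\tau)$ such that $\bigcup_i\{s_i,t_i\}=T$ and each $\sigma_i\in\{\mathrm{odd},\mathrm{even}\}$ (here $st$ is the unordered pair $\{s,t\}$). For $p,q\in\mathbb{Z}^{2\tau}$, distinct $s,t\in T$ and a parity $\sigma$, define $[p,q]_{st,\sigma}:=p_sp_t+q_sq_t$ if $\sigma=\mathrm{odd}$, and $[p,q]_{st,\sigma}:=p_sq_t+q_sp_t$ if $\sigma=\mathrm{even}$. A set $\mathcal{M}$ of PMPs on $T$ is h-representable if there exist $N,k\in\mathbb{Z}_{>0}$, $n_i\in\mathbb{Z}_{\ge 0}$, $p^i,q^i\in\mathbb{Z}^{2\tau}$ for $i=1,\dots,N$ such that a PMP $M$ on $T$ belongs to $\mathcal{M}$ if and only if $\sum_{i=1}^N n_i\prod_{(st,\sigma)\in M}[p^i,q^i]_{st,\sigma}\not\equiv 0 \pmod{2^k}$. -}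

module Defs where

open import Data.Fin.Base using (Fin)
open import Data.Fin.Patterns using (0F; 1F; 2F; 3F; 4F; 5F)
open import Data.Integer.Base using (ℤ; +_; _+_; _*_)
open import Data.Integer.Divisibility using (_∣_)
open import Data.Integer.Properties using (+-0-commutativeMonoid; *-1-commutativeMonoid)
open import Data.Nat.Base as ℕ using (ℕ)
open import Data.Parity.Base using (Parity; 0ℙ; 1ℙ)
open import Data.Product.Base using (Σ-syntax; ∃-syntax; _×_; _,_)
open import Data.Sum.Base using (_⊎_; inj₁; inj₂)
open import Data.Vec.Functional using (Vector)
open import Function.Bundles using (_⇔_)
open import Level using (0ℓ)
open import Relation.Binary.Core using (Rel)
open import Relation.Binary.PropositionalEquality.Core using (_≡_; refl)
open import Relation.Nullary.Negation.Core using (¬_)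
open import Relation.Unary using (Pred; _∈_)

open import Algebra.Properties.CommutativeMonoid.Sum +-0-commutativeMonoid
  using () renaming (sum to ∑)
open import Algebra.Properties.CommutativeMonoid.Sum *-1-commutativeMonoid
  using () renaming (sum to ∏)

pattern even = 0ℙ
pattern odd  = 1ℙ

-- The ground set {1, …, 2τ} is Fin (2 * τ), so labels are shifted down by one.

record Edge (τ : ℕ) : Set where
  constructor edge
  field
    s t : Fin (2 ℕ.* τ)
    σ   : Parity

-- An edge (st, σ) carries an unordered pair, so (s, t, σ) and (t, s, σ) are
-- identified.
_≈ᵉ_ : ∀ {τ} → Rel (Edge τ) 0ℓ
e ≈ᵉ f = ((s e ≡ s f × t e ≡ t f) ⊎ (s e ≡ t f × t e ≡ s f)) × σ e ≡ σ f
  where open Edge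

-- A perfect matching with parity, presented by an enumeration of its τ edges.
-- Since τ pairs cover 2τ points, the endpoints are automatically pairwise
-- distinct; in particular s ≢ t in each edge and no edge is repeated.
record PMP (τ : ℕ) : Set where
  field
    edges  : Vector (Edge τ) τ
    covers : ∀ x → ∃[ i ] (x ≡ Edge.s (edges i) ⊎ x ≡ Edge.t (edges i))

open PMP public

_⊆ᴹ_ : ∀ {τ} → Rel (PMP τ) 0ℓ
M ⊆ᴹ M′ = ∀ i → ∃[ j ] (edges M i ≈ᵉ edges M′ j)

-- Equality of the underlying sets of edges: the enumeration is irrelevant.
_≈ᴹ_ : ∀ {τ} → Rel (PMP τ) 0ℓ
M ≈ᴹ M′ = M ⊆ᴹ M′ × M′ ⊆ᴹ M

-- Only meaningful for edges with distinct endpoints, which all edges of a PMP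
-- have.
[_,_]_ : ∀ {τ} → (p q : Vector ℤ (2 ℕ.* τ)) → Edge τ → ℤ
[ p , q ] edge s t odd  = p s * p t + q s * q t
[ p , q ] edge s t even = p s * q t + q s * p t

h : ∀ {τ N} → Vector ℕ N → (p q : Vector (Vector ℤ (2 ℕ.* τ)) N) → PMP τ → ℤ
h n p q M = ∑ λ i → + n i * ∏ λ j → [ p i , q i ] edges M j

HRepresentable : ∀ {τ} → Pred (PMP τ) 0ℓ → Set
HRepresentable {τ} 𝓜 =
  Σ[ N ∈ ℕ ] Σ[ k ∈ ℕ ] 0 ℕ.< N × 0 ℕ.< k ×
  Σ[ n ∈ Vector ℕ N ] Σ[ p ∈ Vector (Vector ℤ (2 ℕ.* τ)) N ]
  Σ[ q ∈ Vector (Vector ℤ (2 ℕ.* τ)) N ]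
    (∀ (M : PMP τ) → M ∈ 𝓜 ⇔ (¬ (+ (2 ℕ.^ k) ∣ h n p q M)))

pmp₃ : (σ₁ σ₂ σ₃ : Parity) → PMP 3
pmp₃ σ₁ σ₂ σ₃ = record
  { edges = λ where
      0F → edge 0F 1F σ₁
      1F → edge 2F 3F σ₂
      2F → edge 4F 5F σ₃
  ; covers = λ where
      0F → 0F , inj₁ refl
      1F → 0F , inj₂ refl
      2F → 1F , inj₁ refl
      3F → 1F , inj₂ refl
      4F → 2F , inj₁ refl
      5F → 2F , inj₂ refl
  }

𝓜₃ : Pred (PMP 3) 0ℓ
𝓜₃ M = ∃[ σ₁ ] ∃[ σ₂ ] ∃[ σ₃ ] (M ≈ᴹ pmp₃ σ₁ σ₂ σ₃)

{-# OPTIONS --safe #-}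

-- The matrix with entries p s * p t + q s * q t has rank at most 2, so its 3 × 3
-- minor with rows 1, 3, 5 and columns 2, 4, 6 vanishes.  Expanding this minor and
-- summing over i gives a signed relation among the values of h at the six
-- all-odd PMPs that match {1, 3, 5} with {2, 4, 6}.  Exactly one of the six, the
-- diagonal term, lies in 𝓜₃, so 2 ^ k would divide every term of the relation
-- but that one.
module Submission where

open import Defs
open import Data.Fin.Base using (Fin; combine; quotient)
open import Data.Fin.Patterns using (0F; 1F; 2F; 3F; 4F; 5F)
open import Data.Fin.Permutation
  using (Permutation′; id; transpose; _∘ₚ_; _⟨$⟩ʳ_; _⟨$⟩ˡ_; inverseʳ)
open import Data.Fin.Properties using (remQuot-combine)
open import Data.Integer.Base using (ℤ; +_; _+_; _*_; 1ℤ)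
open import Data.Integer.Divisibility.Signed
  using (_∣_; _∣?_; ∣ᵤ⇒∣; ∣⇒∣ᵤ; ∣m∣n⇒∣m+n; ∣m+n∣n⇒∣m)
open import Data.Integer.Properties using (+-0-commutativeMonoid; *-1-commutativeMonoid)
open import Data.Integer.Tactic.RingSolver using (solve-∀)
open import Data.Nat.Base as ℕ using (ℕ)
open import Data.Product.Base using (∃-syntax; _,_; proj₁)
open import Data.Sum.Base using (_⊎_; inj₁; inj₂)
open import Data.Vec.Functional using (Vector)
open import Function.Base using (_∘_)
open import Function.Bundles using (module Equivalence)
open import Relation.Binary.PropositionalEquality
  using (_≡_; _≢_; refl; sym; trans; cong; subst; module ≡-Reasoning)
open import Relation.Nullary.Decidable using (decidable-stable)
open import Relation.Nullary.Negation.Core using (¬_)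
open import Relation.Unary using (_∈_)

open import Algebra.Properties.CommutativeMonoid.Sum +-0-commutativeMonoid
  using (∑-distrib-+; sum-cong-≗) renaming (sum to ∑)
open import Algebra.Properties.CommutativeMonoid.Sum *-1-commutativeMonoid
  using () renaming (sum to ∏)

row col : Fin 3 → Fin 6
row i = combine {3} {2} i 0F
col i = combine {3} {2} i 1F

bipartite : Permutation′ 3 → PMP 3
bipartite π = record
  { edges  = λ i → edge (row i) (col (π ⟨$⟩ʳ i)) odd
  ; covers = λ where
      0F → 0F , inj₁ refl
      1F → covers-col 0F
      2F → 1F , inj₁ refl
      3F → covers-col 1F
      4F → 2F , inj₁ refl
      5F → covers-col 2F
  }
  where
  covers-col : ∀ j → ∃[ i ] (col j ≡ row i ⊎ col j ≡ col (π ⟨$⟩ʳ i))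
  covers-col j = π ⟨$⟩ˡ j , inj₂ (cong col (sym (inverseʳ π {j})))

bipartite-id∈𝓜₃ : bipartite id ∈ 𝓜₃
bipartite-id∈𝓜₃ = odd , odd , odd ,
  (λ where
    0F → 0F , inj₁ (refl , refl) , refl
    1F → 1F , inj₁ (refl , refl) , refl
    2F → 2F , inj₁ (refl , refl) , refl) ,
  (λ where
    0F → 0F , inj₁ (refl , refl) , refl
    1F → 1F , inj₁ (refl , refl) , refl
    2F → 2F , inj₁ (refl , refl) , refl)

-- The fibres of `half` are the three pairs used by every member of `𝓜₃`, so comparing fibres
-- decides membership questions without a case split on the permutation.
half : Fin 6 → Fin 3
half = quotient {3} 2

half-combine : ∀ i (j : Fin 2) → half (combine i j) ≡ i
half-combine i j = cong proj₁ (remQuot-combine i j)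

half-pmp₃ : ∀ {σ₁ σ₂ σ₃} j → let open Edge (edges (pmp₃ σ₁ σ₂ σ₃) j) in half s ≡ half t
half-pmp₃ 0F = refl
half-pmp₃ 1F = refl
half-pmp₃ 2F = refl

half-resp-≈ᵉ : ∀ {e f : Edge 3} → e ≈ᵉ f →
  half (Edge.s f) ≡ half (Edge.t f) → half (Edge.s e) ≡ half (Edge.t e)
half-resp-≈ᵉ (inj₁ (refl , refl) , _) eq = eq
half-resp-≈ᵉ (inj₂ (refl , refl) , _) eq = sym eq

-- Edges of members of `𝓜₃` stay inside one fibre of `half`, while edge `i` of `bipartite π` joins
-- fibre `i` to fibre `π ⟨$⟩ʳ i`.
bipartite∈𝓜₃⇒fixed : ∀ π → bipartite π ∈ 𝓜₃ → ∀ i → π ⟨$⟩ʳ i ≡ i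
bipartite∈𝓜₃⇒fixed π (_ , _ , _ , π⊆ , _) i =
  let j , i≈j = π⊆ i in begin
  π ⟨$⟩ʳ i               ≡⟨ half-combine (π ⟨$⟩ʳ i) 1F ⟨
  half (col (π ⟨$⟩ʳ i))  ≡⟨ half-resp-≈ᵉ i≈j (half-pmp₃ j) ⟨
  half (row i)           ≡⟨ half-combine i 0F ⟩
  i                      ∎
  where open ≡-Reasoning

-- With `id`, all of S₃. As `_∘ₚ_` applies its left factor first, `γ` is the cycle 0 → 1 → 2 → 0.
τ₀₁ τ₁₂ τ₀₂ γ γ⁻¹ : Permutation′ 3
τ₀₁ = transpose 0F 1F
τ₁₂ = transpose 1F 2F
τ₀₂ = transpose 0F 2F
γ   = τ₁₂ ∘ₚ τ₀₁
γ⁻¹ = τ₀₁ ∘ₚ τ₁₂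

-- The vanishing determinant of a product of a 3 × 2 and a 2 × 3 matrix, with even
-- permutations on the left and odd ones on the right; the factors 1ℤ and n match
-- the unfolding of the summands of h.
rank-2-det : ∀ n p₀ p₁ p₂ q₀ q₁ q₂ x₀ x₁ x₂ y₀ y₁ y₂ →
  n * ((p₀ * x₀ + q₀ * y₀) * ((p₁ * x₁ + q₁ * y₁) * ((p₂ * x₂ + q₂ * y₂) * 1ℤ))) +
  n * ((p₀ * x₁ + q₀ * y₁) * ((p₁ * x₂ + q₁ * y₂) * ((p₂ * x₀ + q₂ * y₀) * 1ℤ))) +
  n * ((p₀ * x₂ + q₀ * y₂) * ((p₁ * x₀ + q₁ * y₀) * ((p₂ * x₁ + q₂ * y₁) * 1ℤ)))
  ≡
  n * ((p₀ * x₁ + q₀ * y₁) * ((p₁ * x₀ + q₁ * y₀) * ((p₂ * x₂ + q₂ * y₂) * 1ℤ))) +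
  n * ((p₀ * x₀ + q₀ * y₀) * ((p₁ * x₂ + q₁ * y₂) * ((p₂ * x₁ + q₂ * y₁) * 1ℤ))) +
  n * ((p₀ * x₂ + q₀ * y₂) * ((p₁ * x₁ + q₁ * y₁) * ((p₂ * x₀ + q₂ * y₀) * 1ℤ)))
rank-2-det = solve-∀

∑-distrib-+₃ : ∀ {N} (f g h : Vector ℤ N) →
  ∑ (λ i → f i + g i + h i) ≡ ∑ f + ∑ g + ∑ h
∑-distrib-+₃ f g h =
  trans (∑-distrib-+ (λ i → f i + g i) h) (cong (_+ ∑ h) (∑-distrib-+ f g))

module _ {N} (n : Vector ℕ N) (p q : Vector (Vector ℤ 6) N) where

  summand : Permutation′ 3 → Vector ℤ N
  summand π i = + n i * ∏ λ j → [ p i , q i ] edges (bipartite π) j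

  hᵇ : Permutation′ 3 → ℤ
  hᵇ π = h n p q (bipartite π)

  hᵇ-relation : hᵇ id + hᵇ γ + hᵇ γ⁻¹ ≡ hᵇ τ₀₁ + hᵇ τ₁₂ + hᵇ τ₀₂
  hᵇ-relation = begin
    hᵇ id + hᵇ γ + hᵇ γ⁻¹
      ≡⟨ ∑-distrib-+₃ (summand id) (summand γ) (summand γ⁻¹) ⟨
    ∑ (λ i → summand id i + summand γ i + summand γ⁻¹ i)
      ≡⟨ sum-cong-≗ (λ i → rank-2-det (+ n i)
           (p i 0F) (p i 2F) (p i 4F) (q i 0F) (q i 2F) (q i 4F)
           (p i 1F) (p i 3F) (p i 5F) (q i 1F) (q i 3F) (q i 5F)) ⟩
    ∑ (λ i → summand τ₀₁ i + summand τ₁₂ i + summand τ₀₂ i)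
      ≡⟨ ∑-distrib-+₃ (summand τ₀₁) (summand τ₁₂) (summand τ₀₂) ⟩
    hᵇ τ₀₁ + hᵇ τ₁₂ + hᵇ τ₀₂  ∎
    where open ≡-Reasoning

  ∣hᵇ-id : ∀ {d} → (∀ π i → π ⟨$⟩ʳ i ≢ i → d ∣ hᵇ π) → d ∣ hᵇ id
  ∣hᵇ-id {d} d∣hᵇ =
    ∣m+n∣n⇒∣m {m = hᵇ id} {n = hᵇ γ}
      (∣m+n∣n⇒∣m {m = hᵇ id + hᵇ γ} {n = hᵇ γ⁻¹} d∣even (d∣hᵇ γ⁻¹ 0F λ ()))
      (d∣hᵇ γ 0F λ ())
    where
    d∣even : d ∣ hᵇ id + hᵇ γ + hᵇ γ⁻¹
    d∣even = subst (d ∣_) (sym hᵇ-relation)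
      -- Each permutation needs a point that it moves: `0F` serves for all except `τ₁₂`, which fixes
      -- it.
      (∣m∣n⇒∣m+n (∣m∣n⇒∣m+n (d∣hᵇ τ₀₁ 0F λ ()) (d∣hᵇ τ₁₂ 1F λ ())) (d∣hᵇ τ₀₂ 0F λ ()))

theorem3p5 : ¬ HRepresentable 𝓜₃
theorem3p5 (_ , k , _ , _ , n , p , q , represents) =
  to (represents (bipartite id)) bipartite-id∈𝓜₃
    -- `HRepresentable` uses unsigned divisibility, the sum lemmas the signed one.
    (∣⇒∣ᵤ {i = hᵇ n p q id} (∣hᵇ-id n p q λ π i πi≢i →
      -- Representability only turns non-divisibility into membership. Divisibility is decidable, so
      -- it suffices to refute its negation: that would put `bipartite π` in `𝓜₃`, forcing `π` to
      -- fix `i`.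
      decidable-stable (+ (2 ℕ.^ k) ∣? hᵇ n p q π) λ ∤hᵇ →
        πi≢i (bipartite∈𝓜₃⇒fixed π (from (represents (bipartite π)) (∤hᵇ ∘ ∣ᵤ⇒∣ {i = hᵇ n p q π})) i)))
  where open Equivalence
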